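{- Let $(L,\leq)$ be a finite lattice with least element $\bot$ and greatest element $\top$, and let $\mathrm{bel}:L\to[0,1]$ be a belief function whose Möbius transform $m$ satisfies $m(\top)\neq 0$. Let $q$ be the co-Möbius transform of $\mathrm{bel}$ and let $\mu$ be the Möbius function of $L$. Then $\mathrm{bel}$ admits the decomposition $$\mathrm{bel}=\bigoplus_{y\in L} y^{w_y}$$ in terms of simple support functions $y^{w_y}$ (where $\oplus$ is the Dempster rule of combination), with coefficients given by $$w_y=\prod_{x\geq y} q(x)^{ -\mu(y,x)},\qquad y\in L.$$
   Context: For a function $f:L\to\mathbb{R}$ on a finite lattice $L$, its Möbius transform is the unique function $m:L\to\mathbb{R}$ with $f(x)=\sum_{y\leq x}m(y)$ for all $x\in L$; a function is thus determined by its Möbius transform. The co-Möbius transform of $f$ is $q(x):=\sum_{y\geq x}m(y)$, $x\in L$. The Möbius function $\mu:L^2\to\mathbb{R}$ of $L$ is defined by $\mu(x,y)=1$ if $x=y$, $\mu(x,y)=-\sum_{x\leq t<y}\mu(x,t)$ if $x<y$, and $\mu(x,y)=0$ otherwise. A belief function on $L$ is a function $\mathrm{bel}:L\to[0,1]$ with $\mathrm{bel}(\top)=1$, $\mathrm{bel}(\bot)=0$, and whose Möbius transform is nonnegative. For $y\in L$ and a real number $w$, the simple support function focused on $y$, denoted $y^w$, is the function on $L$ whose Möbius transform takes the value $1-w$ at $y$, the value $w$ at $\top$, and $0$ elsewhere (for $y=\top$ the two values are added, i.e. the Möbius transform of $\top^w$ takes the value $1$ at $\top$ and $0$ elsewhere,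 whatever $w$ is). The coefficients $w_y$ are allowed to be greater than $1$, in which case $y^{w_y}$ is not a belief function. The Dempster rule of combination $f_1\oplus f_2$ of two functions on $L$ with Möbius transforms $m_1,m_2$ is the function on $L$ whose Möbius transform is $(m_1\oplus m_2)(x):=\sum_{y_1\wedge y_2=x}m_1(y_1)m_2(y_2)$ for all $x\in L$ (with no normalization and no resetting of the value at $\bot$); $\bigoplus$ denotes iterated combination (the operation is commutative and associative). -}

module Defs where

open import Level using (_⊔_; suc)
open import Algebra.Bundles using (CommutativeRing; CommutativeMonoid)
open import Algebra.Apartness.Bundles using (HeytingField; HeytingCommutativeRing)
import Algebra.Apartness.Properties.HeytingCommutativeRing as HeytingProperties
import Algebra.Definitions.RawMonoid as RawMonoidDefs
import Algebra.Properties.CommutativeMonoid.Sum as MonoidSum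
import Algebra.Properties.Group as GroupProperties
open import Data.Bool.Base using (if_then_else_)
open import Data.Fin.Base as Fin using (Fin)
import Data.Fin.Properties as Fin
import Data.Fin.Induction as Fin
open import Data.Integer.Base as ℤ using (ℤ; +_; -[1+_])
import Data.Integer.Properties as ℤ
open import Data.Nat.Base as ℕ using (ℕ)
open import Data.Product.Base using (_×_; _,_; proj₁; proj₂; ∃-syntax)
open import Data.Sum.Base using (_⊎_; inj₁; inj₂)
import Data.Vec.Functional as Vector
open import Function.Base using (_∘_)
open import Function.Bundles using (_↔_; Inverse)
open import Induction.WellFounded using (WellFounded; module All; module FixPoint; module Subrelation)
open import Relation.Binary.Core using (Rel)
open import Relation.Binary.Definitions using (DecidableEquality)
open import Relation.Binary.Lattice.Structures using (IsBoundedLattice)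
open import Relation.Binary.PropositionalEquality as ≡ using (_≡_; _≢_; _≗_)
open import Relation.Binary.Structures using (IsStrictPartialOrder)
import Relation.Binary.Construct.NonStrictToStrict as ToStrict
import Relation.Binary.Construct.On as On
import Relation.Binary.Reasoning.Setoid as SetoidReasoning
open import Relation.Nullary.Decidable using (Dec; yes; no; does; map′; _×-dec_; ¬?)
open import Relation.Nullary.Negation using (¬_; contradiction)

-- ℝ as an Archimedean, Cauchy-complete ordered field.  Inequality of
-- reals is the apartness _#_, which the axioms below force to mean
-- "x < y or y < x".  Classically x # y is ¬ (x ≈ y), and the axioms
-- characterise ℝ up to unique isomorphism.

record Reals c ℓ₁ ℓ₂ ℓ₃ : Set (suc (c ⊔ ℓ₁ ⊔ ℓ₂ ⊔ ℓ₃)) where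
  infix 4 _<_ _≤_ _⟶_

  field
    heytingField : HeytingField c ℓ₁ ℓ₂

  open HeytingField heytingField public

  open HeytingCommutativeRing heytingCommutativeRing public
    using (commutativeRing)
  open CommutativeRing commutativeRing public
    using (+-commutativeMonoid; *-commutativeMonoid; +-group)
  open RawMonoidDefs (CommutativeMonoid.rawMonoid +-commutativeMonoid) public
    using () renaming (_×_ to _·_)
  open RawMonoidDefs (CommutativeMonoid.rawMonoid *-commutativeMonoid) public
    using () renaming (_×_ to power)

  field
    _<_                    : Rel Carrier ℓ₃
    <-isStrictPartialOrder : IsStrictPartialOrder _≈_ _<_
    #⇒<⊎>                  : ∀ {x y} → x # y → x < y ⊎ y < x
    <⇒#                    : ∀ {x y} → x < y → x # y
    +-monoˡ-<              : ∀ {x y} z → x < y → x + z < y + z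
    *-pos                  : ∀ {x y} → 0# < x → 0# < y → 0# < x * y
    archimedean            : ∀ x → ∃[ n ] x < n · 1#

  _≤_ : Rel Carrier ℓ₃
  x ≤ y = ¬ (y < x)

  -- |s i - s j| < 1/k, for every k > 0, once i and j are large enough.
  Cauchy : (ℕ → Carrier) → Set ℓ₃
  Cauchy s = ∀ k → ∃[ N ] (∀ i j → N ℕ.≤ i → N ℕ.≤ j → k · (s i - s j) < 1#)

  _⟶_ : (ℕ → Carrier) → Carrier → Set ℓ₃
  s ⟶ l = ∀ k → ∃[ N ] (∀ i → N ℕ.≤ i →
            k · (s i - l) < 1# × k · (l - s i) < 1#)

  field
    complete : ∀ s → Cauchy s → ∃[ l ] s ⟶ l

  inverse : ∀ x → x # 0# → Carrier
  inverse x x#0 = proj₁ (#⇒invertible x#0)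

  pow : ∀ x → x # 0# → ℤ → Carrier
  pow x x#0 (+ n)      = power n x
  pow x x#0 (-[1+ n ]) = power (ℕ.suc n) (inverse x x#0)

  inverse-correct : ∀ x x#0 → inverse x x#0 * x ≈ 1#
  inverse-correct x x#0 =
    trans (*-congˡ (sym (x-0≈x x))) (proj₁ (proj₂ (#⇒invertible x#0)))
    where open HeytingProperties heytingCommutativeRing using (x-0≈x)

  open IsStrictPartialOrder <-isStrictPartialOrder public
    using (<-respˡ-≈; <-respʳ-≈) renaming (irrefl to <-irrefl; trans to <-trans)

  <-cotrans : ∀ {x y} → x < y → ∀ z → x < z ⊎ z < y
  <-cotrans x<y z with #-cotrans (<⇒# x<y) z
  ... | inj₁ x#z with #⇒<⊎> x#z
  ...   | inj₁ x<z = inj₁ x<z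
  ...   | inj₂ z<x = inj₂ (<-trans z<x x<y)
  <-cotrans x<y z | inj₂ z#y with #⇒<⊎> z#y
  ...   | inj₁ z<y = inj₂ z<y
  ...   | inj₂ y<z = inj₁ (<-trans x<y y<z)

  private
    cancel : ∀ {x y} → x + y < y → x < 0#
    cancel {x} {y} x+y<y =
      <-respʳ-≈ (-‿inverseʳ y)
        (<-respˡ-≈ (trans (+-assoc x y (- y))
                       (trans (+-congˡ (-‿inverseʳ y)) (+-identityʳ x)))
          (+-monoˡ-< (- y) x+y<y))

  +-nonneg : ∀ {x y} → 0# ≤ x → 0# ≤ y → 0# ≤ x + y
  +-nonneg {x} {y} 0≤x 0≤y x+y<0 with <-cotrans x+y<0 y
  ... | inj₁ x+y<y = 0≤x (cancel x+y<y)
  ... | inj₂ y<0   = 0≤y y<0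

  +-pos-nonneg : ∀ {x y} → 0# < x → 0# ≤ y → 0# < x + y
  +-pos-nonneg {x} {y} 0<x 0≤y with <-cotrans 0<x (x + y)
  ... | inj₁ 0<x+y = 0<x+y
  ... | inj₂ x+y<x = contradiction (cancel (<-respˡ-≈ (+-comm x y) x+y<x)) 0≤y

  nonneg∧#0⇒pos : ∀ {x} → 0# ≤ x → x # 0# → 0# < x
  nonneg∧#0⇒pos 0≤x x#0 with #⇒<⊎> x#0
  ... | inj₁ x<0 = contradiction x<0 0≤x
  ... | inj₂ 0<x = 0<x

  sum-nonneg : ∀ {n} (t : Fin n → Carrier) → (∀ i → 0# ≤ t i) →
               0# ≤ MonoidSum.sum +-commutativeMonoid t
  sum-nonneg {ℕ.zero}  t 0≤t = <-irrefl refl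
  sum-nonneg {ℕ.suc n} t 0≤t =
    +-nonneg (0≤t Fin.zero) (sum-nonneg (t ∘ Fin.suc) (0≤t ∘ Fin.suc))

  sum-pos : ∀ {n} (t : Fin n → Carrier) → (∀ i → 0# ≤ t i) →
            ∀ i → 0# < t i → 0# < MonoidSum.sum +-commutativeMonoid t
  sum-pos t 0≤t Fin.zero 0<tᵢ =
    +-pos-nonneg 0<tᵢ (sum-nonneg (t ∘ Fin.suc) (0≤t ∘ Fin.suc))
  sum-pos t 0≤t (Fin.suc i) 0<tᵢ =
    <-respʳ-≈ (+-comm _ _)
      (+-pos-nonneg (sum-pos (t ∘ Fin.suc) (0≤t ∘ Fin.suc) i 0<tᵢ) (0≤t Fin.zero))

record FiniteLattice a ℓ : Set (suc (a ⊔ ℓ)) where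
  infix 4 _≤_ _<_ _≟_ _≤?_ _<?_
  infixr 7 _∧_
  infixr 6 _∨_

  field
    Carrier          : Set a
    _≤_              : Rel Carrier ℓ
    _∨_ _∧_          : Carrier → Carrier → Carrier
    ⊤ ⊥              : Carrier
    isBoundedLattice : IsBoundedLattice _≡_ _≤_ _∨_ _∧_ ⊤ ⊥
    size             : ℕ
    enumeration      : Fin size ↔ Carrier

  open IsBoundedLattice isBoundedLattice public
  open Inverse enumeration public
    using () renaming (to to elem; from to index;
                       strictlyInverseˡ to elem-index;
                       strictlyInverseʳ to index-elem)

  _<_ : Rel Carrier (a ⊔ ℓ)
  x < y = x ≤ y × x ≢ y

  abstract
    _≟_ : DecidableEquality Carrier
    x ≟ y = map′ (λ eq → ≡.trans (≡.sym (elem-index x))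
                           (≡.trans (≡.cong elem eq) (elem-index y)))
                 (≡.cong index)
                 (index x Fin.≟ index y)

    _≤?_ : ∀ x y → Dec (x ≤ y)
    x ≤? y = map′ (λ eq → ≡.subst (_≤ y) eq (x∧y≤y x y))
                  (λ x≤y → antisym (x∧y≤x x y) (∧-greatest refl x≤y))
                  ((x ∧ y) ≟ x)

    _<?_ : ∀ x y → Dec (x < y)
    x <? y = (x ≤? y) ×-dec ¬? (x ≟ y)

  <-isStrictPartialOrder : IsStrictPartialOrder _≡_ _<_
  <-isStrictPartialOrder = ToStrict.<-isStrictPartialOrder _≡_ _≤_ isPartialOrder

  <-wellFounded : WellFounded _<_
  <-wellFounded = Subrelation.wellFounded toIndices
    (On.wellFounded index
      (Fin.spo-wellFounded (On.isStrictPartialOrder elem <-isStrictPartialOrder)))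
    where
    toIndices : ∀ {x y} → x < y → elem (index x) < elem (index y)
    toIndices = ≡.subst₂ _<_ (≡.sym (elem-index _)) (≡.sym (elem-index _))

  -- Recursion along _<_: the step at x is handed the values at all
  -- y < x, extended by a default value to a total function.

  below : ∀ {b} {B : Set b} → B → ∀ x → (Carrier → B) → Carrier → B
  below default x g y = if does (y <? x) then g y else default

  extend : ∀ {b} {B : Set b} → B → ∀ x → (∀ {y} → y < x → B) → Carrier → B
  extend default x ih y with y <? x
  ... | yes y<x = ih y<x
  ... | no  _   = default

  <-rec : ∀ {b} {B : Set b} → B → (Carrier → (Carrier → B) → B) → Carrier → B
  <-rec {B = B} default step =
    All.wfRec <-wellFounded _ (λ _ → B) (λ x ih → step x (extend default x ih))

  private
    extend-cong : ∀ {b} {B : Set b} (default : B) x {ih ih′ : ∀ {y} → y < x → B} →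
                  (∀ {y} (y<x : y < x) → ih y<x ≡ ih′ y<x) →
                  extend default x ih ≗ extend default x ih′
    extend-cong default x eq y with y <? x
    ... | yes y<x = eq y<x
    ... | no  _   = ≡.refl

    extend≗below : ∀ {b} {B : Set b} (default : B) x (g : Carrier → B) →
                   extend default x (λ {y} _ → g y) ≗ below default x g
    extend≗below default x g y with y <? x
    ... | yes _ = ≡.refl
    ... | no  _ = ≡.refl

  <-rec-unfold : ∀ {b} {B : Set b} (default : B) step →
                 (∀ x {g h : Carrier → B} → g ≗ h → step x g ≡ step x h) →
                 ∀ x → <-rec default step x ≡ step x (below default x (<-rec default step))
  <-rec-unfold {B = B} default step step-cong x = ≡.trans
    (FixPoint.unfold-wfRec <-wellFounded (λ _ → B) (λ x ih → step x (extend default x ih))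
      (λ x eq → step-cong x (extend-cong default x eq)))
    (step-cong x (extend≗below default x (<-rec default step)))

module Big {a ℓ c ℓ′} (L : FiniteLattice a ℓ) (M : CommutativeMonoid c ℓ′) where
  private module L = FiniteLattice L
  open CommutativeMonoid M
  private module S = MonoidSum M

  infix 3 _when_

  big : (L.Carrier → Carrier) → Carrier
  big f = S.sum (f ∘ L.elem)

  _when_ : ∀ {p} {P : Set p} → Carrier → Dec P → Carrier
  x when P? = if does P? then x else ε

  big-cong : ∀ {f g} → (∀ x → f x ≈ g x) → big f ≈ big g
  big-cong eq = S.sum-cong-≋ (eq ∘ L.elem)

  big-cong-≡ : ∀ {f g} → f ≗ g → big f ≡ big g
  big-cong-≡ eq = S.sum-cong-≗ (eq ∘ L.elem)

  private
    sum-ε : ∀ {n} (t : Fin n → Carrier) → (∀ i → t i ≈ ε) → S.sum t ≈ ε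
    sum-ε {n} t eq = trans (S.sum-cong-≋ eq) (S.sum-replicate-zero n)

    sum-single : ∀ {n} (t : Fin n → Carrier) i →
                 (∀ j → j ≢ i → t j ≈ ε) → S.sum t ≈ t i
    sum-single t Fin.zero eq =
      trans (∙-congˡ (sum-ε (t ∘ Fin.suc) (λ j → eq (Fin.suc j) (λ ()))))
            (identityʳ _)
    sum-single t (Fin.suc i) eq =
      trans (∙-cong (eq Fin.zero (λ ()))
                    (sum-single (t ∘ Fin.suc) i
                      (λ j j≢i → eq (Fin.suc j) (j≢i ∘ Fin.suc-injective))))
            (identityˡ _)

  big-single : ∀ (f : L.Carrier → Carrier) x →
               (∀ y → y ≢ x → f y ≈ ε) → big f ≈ f x
  big-single f x eq = trans
    (sum-single (f ∘ L.elem) (L.index x)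
      (λ j j≢x → eq (L.elem j)
        (λ y≡x → j≢x (≡.trans (≡.sym (L.index-elem j)) (≡.cong L.index y≡x)))))
    (reflexive (≡.cong f (L.elem-index x)))

  big-≤-split : ∀ (f : L.Carrier → Carrier) x →
                big (λ y → f y when y L.≤? x) ≈ f x ∙ big (λ y → f y when y L.<? x)
  big-≤-split f x = begin
    big (λ y → f y when y L.≤? x)
      ≈⟨ big-cong pointwise ⟩
    big (λ y → (f y when y L.≟ x) ∙ (f y when y L.<? x))
      ≈⟨ S.∑-distrib-+ (λ i → f (L.elem i) when L.elem i L.≟ x)
                       (λ i → f (L.elem i) when L.elem i L.<? x) ⟩
    big (λ y → f y when y L.≟ x) ∙ big (λ y → f y when y L.<? x)
      ≈⟨ ∙-congʳ (trans (big-single (λ y → f y when y L.≟ x) x off) on) ⟩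
    f x ∙ big (λ y → f y when y L.<? x) ∎
    where
    open SetoidReasoning setoid
    off : ∀ y → y ≢ x → (f y when y L.≟ x) ≈ ε
    off y y≢x with y L.≟ x
    ... | yes y≡x = contradiction y≡x y≢x
    ... | no  _   = refl
    on : (f x when x L.≟ x) ≈ f x
    on with x L.≟ x
    ... | yes _   = refl
    ... | no  x≢x = contradiction ≡.refl x≢x
    pointwise : ∀ y → (f y when y L.≤? x) ≈ (f y when y L.≟ x) ∙ (f y when y L.<? x)
    pointwise y with y L.≤? x | y L.≟ x | y L.<? x
    ... | yes _   | yes y≡x | yes y<x = contradiction y≡x (proj₂ y<x)
    ... | yes _   | yes _   | no  _   = sym (identityʳ _)
    ... | yes _   | no  _   | yes _   = sym (identityˡ _)
    ... | yes y≤x | no  y≢x | no  y≮x = contradiction (y≤x , y≢x) y≮x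
    ... | no  y≰x | yes y≡x | _       = contradiction (L.reflexive y≡x) y≰x
    ... | no  y≰x | no  _   | yes y<x = contradiction (proj₁ y<x) y≰x
    ... | no  _   | no  _   | no  _   = sym (identityˡ _)

module BeliefFunctions
  {c ℓ₁ ℓ₂ ℓ₃ a ℓ} (ℝ : Reals c ℓ₁ ℓ₂ ℓ₃) (L : FiniteLattice a ℓ) where

  open Reals ℝ public
    using (_≈_; _#_; _+_; _*_; _-_; -_; 0#; 1#; pow)
    renaming (Carrier to Real; _≤_ to _≤ᴿ_)
  open FiniteLattice L public
    using (_≤_; _<_; _∧_; ⊤; ⊥; _≟_; _≤?_; _<?_)
    renaming (Carrier to Elem)

  private
    module R = Reals ℝ
    module L = FiniteLattice L

  open Big L R.+-commutativeMonoid public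
    using (_when_) renaming (big to ∑)
  open Big L R.*-commutativeMonoid public
    using () renaming (big to ∏; _when_ to _when*_)
  open Big L ℤ.+-0-commutativeMonoid public
    using () renaming (big to ∑ℤ; _when_ to _whenℤ_)

  private
    module S = Big L R.+-commutativeMonoid
    module Z = Big L ℤ.+-0-commutativeMonoid

  IsMöbiusTransform : (f m : Elem → Real) → Set _
  IsMöbiusTransform f m = ∀ x → f x ≈ ∑ λ y → m y when y ≤? x

  fromMöbius : (Elem → Real) → Elem → Real
  fromMöbius m x = ∑ λ y → m y when y ≤? x

  -- The defining equation solved for m x; möbius-correct and
  -- möbius-unique below show that this is the Möbius transform.
  möbius : (Elem → Real) → Elem → Real
  möbius f = L.<-rec 0# λ x m → f x - ∑ λ y → m y when y <? x

  coMöbius : (Elem → Real) → Elem → Real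
  coMöbius f x = ∑ λ y → möbius f y when x ≤? y

  -- The Möbius function of a finite lattice is integer-valued, so the
  -- powers q(x)^(- μ(y,x)) below are integer powers.
  μ : Elem → Elem → ℤ
  μ x = L.<-rec (+ 0) λ y μx →
    if does (x ≟ y) then + 1 else
    if does (x ≤? y) then ℤ.- ∑ℤ (λ t → μx t whenℤ ((x ≤? t) ×-dec (t <? y))) else
    + 0

  record IsBelief (bel : Elem → Real) : Set (a ⊔ ℓ₁ ⊔ ℓ₃) where
    field
      nonneg        : ∀ x → 0# ≤ᴿ bel x
      ≤1            : ∀ x → bel x ≤ᴿ 1#
      bel-⊤         : bel ⊤ ≈ 1#
      bel-⊥         : bel ⊥ ≈ 0#
      möbius-nonneg : ∀ x → 0# ≤ᴿ möbius bel x

  infix 8 _^_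

  -- For y = ⊤ the two summands add up to 1#.
  _^_ : Elem → Real → Elem → Real
  y ^ w = fromMöbius λ x → (1# - w when x ≟ y) + (w when x ≟ ⊤)

  infixl 6 _⊕ᵐ_ _⊕_

  _⊕ᵐ_ : (m₁ m₂ : Elem → Real) → Elem → Real
  (m₁ ⊕ᵐ m₂) x = ∑ λ y₁ → ∑ λ y₂ → m₁ y₁ * m₂ y₂ when (y₁ ∧ y₂) ≟ x

  _⊕_ : (f₁ f₂ : Elem → Real) → Elem → Real
  f₁ ⊕ f₂ = fromMöbius (möbius f₁ ⊕ᵐ möbius f₂)

  -- The neutral element of ⊕; it coincides with ⊤ ^ w for every w.
  vacuous : Elem → Real
  vacuous = fromMöbius λ x → 1# when x ≟ ⊤

  ⨁ : (Elem → Elem → Real) → Elem → Real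
  ⨁ f = Vector.foldr _⊕_ vacuous (f ∘ L.elem)

  private
    when-below : ∀ (g : Elem → Real) x y →
                 (L.below 0# x g y when y <? x) ≡ (g y when y <? x)
    when-below g x y with y <? x
    ... | yes _ = ≡.refl
    ... | no  _ = ≡.refl

  möbius-unfold : ∀ f x → möbius f x ≡ f x - ∑ λ y → möbius f y when y <? x
  möbius-unfold f x = ≡.trans
    (L.<-rec-unfold 0# (λ x m → f x - ∑ λ y → m y when y <? x)
      (λ x eq → ≡.cong (λ s → f x - s)
        (S.big-cong-≡ (λ y → ≡.cong (_when y <? x) (eq y)))) x)
    (≡.cong (λ s → f x - s) (S.big-cong-≡ (when-below (möbius f) x)))

  möbius-correct : ∀ f → IsMöbiusTransform f (möbius f)
  möbius-correct f x = R.sym (begin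
    ∑ (λ y → möbius f y when y ≤? x)  ≈⟨ S.big-≤-split (möbius f) x ⟩
    möbius f x + s                    ≡⟨ ≡.cong (_+ s) (möbius-unfold f x) ⟩
    f x - s + s                       ≈⟨ GroupProperties.//-rightDividesˡ R.+-group s (f x) ⟩
    f x                               ∎)
    where
    open SetoidReasoning R.setoid
    s = ∑ λ y → möbius f y when y <? x

  möbius-unique : ∀ f m → IsMöbiusTransform f m → ∀ x → m x ≈ möbius f x
  möbius-unique f m f≈ = All.wfRec L.<-wellFounded _ (λ x → m x ≈ möbius f x) step
    where
    open SetoidReasoning R.setoid
    step : ∀ x → (∀ {y} → y < x → m y ≈ möbius f y) → m x ≈ möbius f x
    step x ih = begin
      m x          ≈⟨ GroupProperties.//-rightDividesʳ R.+-group s (m x) ⟨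
      m x + s - s  ≈⟨ R.+-congʳ (R.trans (f≈ x) (S.big-≤-split m x)) ⟨
      f x - s      ≈⟨ R.+-congˡ (R.-‿cong (S.big-cong eq)) ⟩
      f x - t      ≡⟨ möbius-unfold f x ⟨
      möbius f x   ∎
      where
      s = ∑ λ y → m y when y <? x
      t = ∑ λ y → möbius f y when y <? x
      eq : ∀ y → (m y when y <? x) ≈ (möbius f y when y <? x)
      eq y with y <? x
      ... | yes y<x = ih y<x
      ... | no  _   = R.refl

  private
    μ-step : Elem → Elem → (Elem → ℤ) → ℤ
    μ-step x y g =
      if does (x ≟ y) then + 1 else
      if does (x ≤? y) then ℤ.- ∑ℤ (λ t → g t whenℤ ((x ≤? t) ×-dec (t <? y))) else
      + 0

    μ-step-cong : ∀ x y {g h} →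
                  (∀ t → (g t whenℤ ((x ≤? t) ×-dec (t <? y)))
                       ≡ (h t whenℤ ((x ≤? t) ×-dec (t <? y)))) →
                  μ-step x y g ≡ μ-step x y h
    μ-step-cong x y eq with x ≟ y | x ≤? y
    ... | yes _ | _     = ≡.refl
    ... | no  _ | yes _ = ≡.cong ℤ.-_ (Z.big-cong-≡ eq)
    ... | no  _ | no  _ = ≡.refl

    μ-unfold : ∀ x y → μ x y ≡ μ-step x y (μ x)
    μ-unfold x y = ≡.trans
      (L.<-rec-unfold (+ 0) (μ-step x)
        (λ z eq → μ-step-cong x z
          (λ t → ≡.cong (_whenℤ ((x ≤? t) ×-dec (t <? z))) (eq t))) y)
      (μ-step-cong x y eq)
      where
      eq : ∀ t → (L.below (+ 0) y (μ x) t whenℤ ((x ≤? t) ×-dec (t <? y)))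
               ≡ (μ x t whenℤ ((x ≤? t) ×-dec (t <? y)))
      eq t with x ≤? t | t <? y
      ... | yes _ | yes _ = ≡.refl
      ... | yes _ | no  _ = ≡.refl
      ... | no  _ | _     = ≡.refl

  μ-refl : ∀ x → μ x x ≡ + 1
  μ-refl x = ≡.trans (μ-unfold x x) eq
    where
    eq : μ-step x x (μ x) ≡ + 1
    eq with x ≟ x
    ... | yes _   = ≡.refl
    ... | no  x≢x = contradiction ≡.refl x≢x

  μ-< : ∀ {x y} → x < y →
        μ x y ≡ ℤ.- ∑ℤ λ t → μ x t whenℤ ((x ≤? t) ×-dec (t <? y))
  μ-< {x} {y} (x≤y , x≢y) = ≡.trans (μ-unfold x y) eq
    where
    eq : μ-step x y (μ x) ≡ ℤ.- ∑ℤ λ t → μ x t whenℤ ((x ≤? t) ×-dec (t <? y))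
    eq with x ≟ y | x ≤? y
    ... | yes x≡y | _       = contradiction x≡y x≢y
    ... | no  _   | yes _   = ≡.refl
    ... | no  _   | no  x≰y = contradiction x≤y x≰y

  μ-≰ : ∀ {x y} → ¬ (x ≤ y) → μ x y ≡ + 0
  μ-≰ {x} {y} x≰y = ≡.trans (μ-unfold x y) eq
    where
    eq : μ-step x y (μ x) ≡ + 0
    eq with x ≟ y | x ≤? y
    ... | yes x≡y | _       = contradiction (L.reflexive x≡y) x≰y
    ... | no  _   | yes x≤y = contradiction x≤y x≰y
    ... | no  _   | no  _   = ≡.refl

  module _ {bel : Elem → Real} (isBelief : IsBelief bel)
           (m⊤#0 : möbius bel ⊤ # 0#) where

    open IsBelief isBelief

    -- q x ≥ m ⊤ > 0, so that integer powers of q x make sense.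
    coMöbius#0 : ∀ x → coMöbius bel x # 0#
    coMöbius#0 x = R.#-sym (R.<⇒# (R.sum-pos (term ∘ L.elem) (nonneg-term ∘ L.elem)
                     (L.index ⊤) (≡.subst (λ y → 0# R.< term y)
                       (≡.sym (L.elem-index ⊤)) pos-⊤)))
      where
      term : Elem → Real
      term y = möbius bel y when x ≤? y
      nonneg-term : ∀ y → 0# ≤ᴿ term y
      nonneg-term y with x ≤? y
      ... | yes _ = möbius-nonneg y
      ... | no  _ = R.<-irrefl R.refl
      pos-⊤ : 0# R.< term ⊤
      pos-⊤ with x ≤? ⊤
      ... | yes _   = R.nonneg∧#0⇒pos (möbius-nonneg ⊤) m⊤#0
      ... | no  x≰⊤ = contradiction (L.maximum x) x≰⊤

    weight : Elem → Real
    weight y = ∏ λ x → pow (coMöbius bel x) (coMöbius#0 x) (ℤ.- μ y x) when* y ≤? x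

{-# OPTIONS --safe #-}
-- The co-Möbius transform f ↦ q is injective and turns ⊕ into the pointwise
-- product.  At z, the simple support function y ^ w has co-Möbius value 1 if
-- z ≤ y and w otherwise.  So it suffices that the product of the w_y over all
-- y with z ≰ y is q(z), that is, the product of all the w_y divided by that of
-- the w_y with z ≤ y.  Because Σ_{z ≤ y} μ(y,x) = [x = z], the product of the
-- w_y over y ≥ z is q(z)⁻¹; for z = ⊥ this gives that the product of all the
-- w_y is q(⊥)⁻¹ = bel(⊤)⁻¹ = 1.

module Submission where

open import Defs
open import Algebra.Bundles using (AbelianGroup; CommutativeMonoid; CommutativeRing)
open import Algebra.Definitions using (RightCancellative)
import Algebra.Properties.CommutativeMonoid.Mult as Mult
import Algebra.Properties.CommutativeMonoid.Sum as MonoidSum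
import Algebra.Properties.CommutativeSemigroup as CommutativeSemigroupProperties
import Algebra.Properties.Group as GroupProperties
import Algebra.Properties.Semiring.Sum as SemiringSum
open import Data.Bool.Properties using (if-float)
open import Data.Fin.Base as Fin using (Fin)
open import Data.Integer.Base as ℤ using (ℤ; +_; -[1+_])
import Data.Integer.Properties as ℤ
open import Data.Nat.Base as ℕ using (ℕ)
open import Data.Product.Base using (_,_)
import Data.Vec.Functional as Vector
open import Function.Base using (_∘_; flip)
open import Induction.WellFounded using (module All)
open import Relation.Binary.PropositionalEquality as ≡ using (_≡_)
import Relation.Binary.Reasoning.Setoid as SetoidReasoning
open import Relation.Nullary.Decidable using (Dec; yes; no; does; _×-dec_)
open import Relation.Nullary.Negation using (¬_; contradiction)

-- Order duality of finite lattices.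

dual : ∀ {a ℓ} → FiniteLattice a ℓ → FiniteLattice a ℓ
dual L = record
  { Carrier          = L.Carrier
  ; _≤_              = flip L._≤_
  ; _∨_              = L._∧_
  ; _∧_              = L._∨_
  ; ⊤                = L.⊥
  ; ⊥                = L.⊤
  ; isBoundedLattice = record
    { isLattice = record
      { isPartialOrder = record
        { isPreorder = record
          { isEquivalence = ≡.isEquivalence
          ; reflexive     = L.reflexive ∘ ≡.sym
          ; trans         = flip L.trans
          }
        ; antisym = flip L.antisym
        }
      ; supremum = L.infimum
      ; infimum  = L.supremum
      }
    ; maximum = L.minimum
    ; minimum = L.maximum
    }
  ; size        = L.size
  ; enumeration = L.enumeration
  }
  where module L = FiniteLattice L

-- Conditional sums over a finite lattice, valued in any commutative monoid.

module BigProperties {a ℓ c ℓ′} (L : FiniteLattice a ℓ) (M : CommutativeMonoid c ℓ′) where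
  private module L = FiniteLattice L
  open CommutativeMonoid M
  private module S = MonoidSum M
  open Big L M
  open SetoidReasoning setoid

  -- Lets one decision be traded for another: of an equivalent proposition, or of the same one
  -- decided differently.
  when-⇔ : ∀ {p r} {P : Set p} {Q : Set r} x (P? : Dec P) (Q? : Dec Q) →
           (P → Q) → (Q → P) → (x when P?) ≡ (x when Q?)
  when-⇔ x (yes _) (yes _) _   _   = ≡.refl
  when-⇔ x (yes p) (no ¬q) P⇒Q _   = contradiction (P⇒Q p) ¬q
  when-⇔ x (no ¬p) (yes q) _   Q⇒P = contradiction (Q⇒P q) ¬p
  when-⇔ x (no _)  (no _)  _   _   = ≡.refl

  when-true : ∀ {p} {P : Set p} x (P? : Dec P) → P → (x when P?) ≡ x
  when-true x (yes _) p = ≡.refl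
  when-true x (no ¬p) p = contradiction p ¬p

  when-false : ∀ {p} {P : Set p} x (P? : Dec P) → ¬ P → (x when P?) ≡ ε
  when-false x (yes p) ¬p = contradiction p ¬p
  when-false x (no _)  ¬p = ≡.refl

  when-cong : ∀ {p} {P : Set p} {x y} (P? : Dec P) → (P → x ≈ y) → (x when P?) ≈ (y when P?)
  when-cong (yes p) eq = eq p
  when-cong (no _)  eq = refl

  ε-when : ∀ {p} {P : Set p} (P? : Dec P) → (ε when P?) ≡ ε
  ε-when (yes _) = ≡.refl
  ε-when (no _)  = ≡.refl

  when-vanishing : ∀ {p} {P : Set p} {x} (P? : Dec P) → (P → x ≈ ε) → (x when P?) ≈ ε
  when-vanishing P? eq = trans (when-cong P? eq) (reflexive (ε-when P?))

  when-redundant : ∀ {p} {P : Set p} {x} (P? : Dec P) → (¬ P → x ≈ ε) → (x when P?) ≈ x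
  when-redundant (yes _) eq = refl
  when-redundant (no ¬p) eq = sym (eq ¬p)

  when-×-redundant : ∀ {p r} {P : Set p} {Q : Set r} {x} (P? : Dec P) (Q? : Dec Q) →
                     (¬ P → x ≈ ε) → (x when (P? ×-dec Q?)) ≈ (x when Q?)
  when-×-redundant (yes _) Q? eq = refl
  when-×-redundant (no ¬p) Q? eq = sym (when-vanishing Q? (λ _ → eq ¬p))

  when-swap : ∀ {p r} {P : Set p} {Q : Set r} x (P? : Dec P) (Q? : Dec Q) →
              ((x when P?) when Q?) ≡ ((x when Q?) when P?)
  when-swap x (yes _) Q? = ≡.refl
  when-swap x (no _)  Q? = ε-when Q?

  when-∙ : ∀ {p} {P : Set p} x y (P? : Dec P) →
           (x ∙ y when P?) ≈ (x when P?) ∙ (y when P?)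
  when-∙ x y (yes _) = refl
  when-∙ x y (no _)  = sym (identityˡ ε)

  big-ε : ∀ {f} → (∀ x → f x ≈ ε) → big f ≈ ε
  big-ε eq = trans (S.sum-cong-≋ (eq ∘ L.elem)) (S.sum-replicate-zero L.size)

  big-∙ : ∀ f g → big (λ x → f x ∙ g x) ≈ big f ∙ big g
  big-∙ f g = S.∑-distrib-+ (f ∘ L.elem) (g ∘ L.elem)

  big-swap : ∀ (f : L.Carrier → L.Carrier → Carrier) →
             big (λ x → big (f x)) ≈ big (λ y → big (λ x → f x y))
  big-swap f = S.∑-comm (λ i j → f (L.elem i) (L.elem j))

  big-when : ∀ {p} {P : Set p} f (P? : Dec P) → (big f when P?) ≈ big (λ x → f x when P?)
  big-when f (yes _) = refl
  big-when f (no _)  = sym (big-ε (λ _ → refl))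

  big-≟ : ∀ (f : L.Carrier → Carrier) x → big (λ y → f y when y L.≟ x) ≈ f x
  big-≟ f x = trans
    (big-single (λ y → f y when y L.≟ x) x (λ y y≢x → reflexive (when-false (f y) (y L.≟ x) y≢x)))
    (reflexive (when-true (f x) (x L.≟ x) ≡.refl))

  big-single-when : ∀ {p} {P : L.Carrier → Set p} (P? : ∀ y → Dec (P y)) z x →
                    big (λ y → (z when y L.≟ x) when P? y) ≈ (z when P? x)
  big-single-when P? z x = trans
    (big-cong (λ y → reflexive (when-swap z (y L.≟ x) (P? y))))
    (big-≟ (λ y → z when P? y) x)

  -- The system is triangular: at x, the sums over y < x agree by induction and can be cancelled.
  -- Asking only for cancellation lets the lemma serve both integers and reals.
  ζ-injective : RightCancellative _≈_ _∙_ → ∀ f g →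
                (∀ x → big (λ y → f y when y L.≤? x) ≈ big (λ y → g y when y L.≤? x)) →
                ∀ x → f x ≈ g x
  ζ-injective cancel f g eq = All.wfRec L.<-wellFounded _ (λ x → f x ≈ g x) step
    where
    step : ∀ x → (∀ {y} → y L.< x → f y ≈ g y) → f x ≈ g x
    step x ih = cancel (big (λ y → g y when y L.<? x)) (f x) (g x) (begin
      f x ∙ big (λ y → g y when y L.<? x)  ≈⟨ ∙-congˡ (big-cong λ y → when-cong (y L.<? x) ih) ⟨
      f x ∙ big (λ y → f y when y L.<? x)  ≈⟨ big-≤-split f x ⟨
      big (λ y → f y when y L.≤? x)        ≈⟨ eq x ⟩
      big (λ y → g y when y L.≤? x)        ≈⟨ big-≤-split g x ⟩
      g x ∙ big (λ y → g y when y L.<? x)  ∎)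

module _ {a ℓ c ℓ′} (L : FiniteLattice a ℓ) (M : CommutativeMonoid c ℓ′) where
  private
    module L  = FiniteLattice L
    module Lᵒ = FiniteLattice (dual L)
  open CommutativeMonoid M
  open Big L M
  open BigProperties L M

  -- Sums over the elements above x are sums over those below x in the dual lattice, where
  -- `ζ-injective` applies.
  ζᵒ-injective : RightCancellative _≈_ _∙_ → ∀ f g →
                 (∀ x → big (λ y → f y when x L.≤? y) ≈ big (λ y → g y when x L.≤? y)) →
                 ∀ x → f x ≈ g x
  ζᵒ-injective cancel f g eq = BigProperties.ζ-injective (dual L) M cancel f g
    (λ x → trans (flipped f x) (trans (eq x) (sym (flipped g x))))
    where
    flipped : ∀ h x → big (λ y → h y when y Lᵒ.≤? x) ≈ big (λ y → h y when x L.≤? y)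
    -- The dual lattice decides its order through joins instead of meets. The two propositions
    -- coincide, but their decisions are different terms.
    flipped h x = big-cong (λ y →
      reflexive (when-⇔ (h y) (y Lᵒ.≤? x) (x L.≤? y) (λ p → p) (λ p → p)))

-- Integer powers of a real apart from zero.

module RealPowers {c ℓ₁ ℓ₂ ℓ₃} (ℝ : Reals c ℓ₁ ℓ₂ ℓ₃) where
  open Reals ℝ
  open SetoidReasoning setoid
  open Mult *-commutativeMonoid using (×-homo-+)

  module _ (x : Carrier) (x#0 : x # 0#) where
    private x⁻¹ = inverse x x#0

    -- Integer addition of mixed signs computes to `⊖`, so this supplies the mixed cases of `pow-+`.
    -- The recursion lowers both exponents together, and the factor `x * x⁻¹` put back each time is
    -- 1.
    pow-⊖ : ∀ m n → pow x x#0 (m ℤ.⊖ n) ≈ power m x * power n x⁻¹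
    pow-⊖ ℕ.zero    ℕ.zero    = sym (*-identityˡ 1#)
    pow-⊖ ℕ.zero    (ℕ.suc n) = sym (*-identityˡ _)
    pow-⊖ (ℕ.suc m) ℕ.zero    = sym (*-identityʳ _)
    pow-⊖ (ℕ.suc m) (ℕ.suc n) = begin
      pow x x#0 (ℕ.suc m ℤ.⊖ ℕ.suc n)            ≡⟨ ≡.cong (pow x x#0) (ℤ.[1+m]⊖[1+n]≡m⊖n m n) ⟩
      pow x x#0 (m ℤ.⊖ n)                        ≈⟨ pow-⊖ m n ⟩
      power m x * power n x⁻¹                    ≈⟨ *-identityˡ _ ⟨
      1# * (power m x * power n x⁻¹)             ≈⟨ *-congʳ (trans (*-comm x x⁻¹) (inverse-correct x x#0)) ⟨
      (x * x⁻¹) * (power m x * power n x⁻¹)      ≈⟨ interchange x x⁻¹ _ _ ⟩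
      (x * power m x) * (x⁻¹ * power n x⁻¹)      ∎
      where
      open CommutativeSemigroupProperties
        (CommutativeMonoid.commutativeSemigroup *-commutativeMonoid) using (interchange)

    pow-+ : ∀ i j → pow x x#0 (i ℤ.+ j) ≈ pow x x#0 i * pow x x#0 j
    pow-+ (+ m)    (+ n)    = ×-homo-+ x m n
    pow-+ (+ m)    -[1+ n ] = pow-⊖ m (ℕ.suc n)
    pow-+ -[1+ m ] (+ n)    = trans (pow-⊖ n (ℕ.suc m)) (*-comm _ _)
    pow-+ -[1+ m ] -[1+ n ] = trans
      -- The exponent on the left is 2 + m + n, so one factor `x⁻¹` stands outside the split power;
      -- the remaining steps carry it over to the n factors.
      (*-congˡ (×-homo-+ x⁻¹ (ℕ.suc m) n))
      (trans (*-congˡ (*-comm _ _)) (trans (sym (*-assoc _ _ _)) (*-comm _ _)))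

    pow-sum : ∀ {n} (t : Fin n → ℤ) →
              pow x x#0 (MonoidSum.sum ℤ.+-0-commutativeMonoid t)
                ≈ MonoidSum.sum *-commutativeMonoid (pow x x#0 ∘ t)
    pow-sum {ℕ.zero}  t = refl
    pow-sum {ℕ.suc n} t = trans (pow-+ (t Fin.zero) _) (*-congˡ (pow-sum (t ∘ Fin.suc)))

-- The Möbius function as inverse of the zeta function.

module _ {c ℓ₁ ℓ₂ ℓ₃ a ℓ} (ℝ : Reals c ℓ₁ ℓ₂ ℓ₃) (L : FiniteLattice a ℓ) where
  open BeliefFunctions ℝ L
  private
    module R   = Reals ℝ
    module L   = FiniteLattice L
    module S   = Big L R.+-commutativeMonoid
    module S′  = BigProperties L R.+-commutativeMonoid
    module P   = Big L R.*-commutativeMonoid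
    module P′  = BigProperties L R.*-commutativeMonoid
    module Z   = Big L ℤ.+-0-commutativeMonoid
    module Z′  = BigProperties L ℤ.+-0-commutativeMonoid
    module ℤ+  = AbelianGroup ℤ.+-0-abelianGroup

  -- The recurrence for `μ` makes the values on the interval from x to y cancel when x < y, and
  -- `μ-≰` removes the terms outside it. In the incidence algebra this is μζ = δ.
  μ-row : ∀ x y → ∑ℤ (λ t → μ x t whenℤ t ≤? y) ≡ (+ 1 whenℤ x ≟ y)
  -- Passing the decisions as arguments leaves the conditional in the goal intact, for `when-true`
  -- and `when-false` to rewrite.
  μ-row x y = cases (x ≟ y) (x ≤? y)
    where
    open ≡.≡-Reasoning
    cases : Dec (x ≡ y) → Dec (x ≤ y) →
            ∑ℤ (λ t → μ x t whenℤ t ≤? y) ≡ (+ 1 whenℤ x ≟ y)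
    cases (yes ≡.refl) _ = begin
      ∑ℤ (λ t → μ x t whenℤ t ≤? x)            ≡⟨ Z.big-≤-split (μ x) x ⟩
      μ x x ℤ.+ ∑ℤ (λ t → μ x t whenℤ t <? x)  ≡⟨ ≡.cong₂ ℤ._+_ (μ-refl x) (Z′.big-ε λ t →
        Z′.when-vanishing (t <? x) λ (t≤x , t≢x) → μ-≰ λ x≤t → t≢x (L.antisym t≤x x≤t)) ⟩
      + 1                                      ≡⟨ Z′.when-true (+ 1) (x ≟ x) ≡.refl ⟨
      (+ 1 whenℤ x ≟ x)                        ∎
    cases (no x≢y) (yes x≤y) = begin
      ∑ℤ (λ t → μ x t whenℤ t ≤? y)
        ≡⟨ Z.big-≤-split (μ x) y ⟩
      μ x y ℤ.+ ∑ℤ (λ t → μ x t whenℤ t <? y)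
        ≡⟨ ≡.cong₂ ℤ._+_ (μ-< (x≤y , x≢y))
             -- The recurrence also demands x ≤ t; this can be added because `μ x t` is zero for all
             -- other t.
             (Z.big-cong λ t → ≡.sym (Z′.when-×-redundant (x ≤? t) (t <? y) μ-≰)) ⟩
      ℤ.- s ℤ.+ s
        ≡⟨ ℤ.+-inverseˡ s ⟩
      + 0
        ≡⟨ Z′.when-false (+ 1) (x ≟ y) x≢y ⟨
      (+ 1 whenℤ x ≟ y) ∎
      where
      s = ∑ℤ λ t → μ x t whenℤ ((x ≤? t) ×-dec (t <? y))
    cases (no x≢y) (no x≰y) = begin
      ∑ℤ (λ t → μ x t whenℤ t ≤? y)  ≡⟨ Z′.big-ε (λ t → Z′.when-vanishing (t ≤? y)
        λ t≤y → μ-≰ λ x≤t → x≰y (L.trans x≤t t≤y)) ⟩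
      + 0                            ≡⟨ Z′.when-false (+ 1) (x ≟ y) x≢y ⟨
      (+ 1 whenℤ x ≟ y)              ∎

  -- A one-sided inverse of ζ is two-sided: multiplying the left-hand side
  -- by ζ on the right gives ζ, by μ-row, and ζ can be cancelled.
  μ-column : ∀ z x → ∑ℤ (λ y → μ y x whenℤ z ≤? y) ≡ (+ 1 whenℤ x ≟ z)
  μ-column z = Z′.ζ-injective (λ k i j → GroupProperties.∙-cancelʳ ℤ+.group k i j)
    (λ x → ∑ℤ (λ y → μ y x whenℤ z ≤? y)) (λ x → + 1 whenℤ x ≟ z) λ u → begin
      ∑ℤ (λ x → ∑ℤ (λ y → μ y x whenℤ z ≤? y) whenℤ x ≤? u)
        ≡⟨ Z.big-cong (λ x → Z′.big-when (λ y → μ y x whenℤ z ≤? y) (x ≤? u)) ⟩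
      ∑ℤ (λ x → ∑ℤ λ y → (μ y x whenℤ z ≤? y) whenℤ x ≤? u)
        ≡⟨ Z′.big-swap (λ x y → (μ y x whenℤ z ≤? y) whenℤ x ≤? u) ⟩
      ∑ℤ (λ y → ∑ℤ λ x → (μ y x whenℤ z ≤? y) whenℤ x ≤? u)
        ≡⟨ Z.big-cong (λ y → Z.big-cong λ x → Z′.when-swap (μ y x) (z ≤? y) (x ≤? u)) ⟩
      ∑ℤ (λ y → ∑ℤ λ x → (μ y x whenℤ x ≤? u) whenℤ z ≤? y)
        ≡⟨ Z.big-cong (λ y → Z′.big-when (λ x → μ y x whenℤ x ≤? u) (z ≤? y)) ⟨
      ∑ℤ (λ y → ∑ℤ (λ x → μ y x whenℤ x ≤? u) whenℤ z ≤? y)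
        ≡⟨ Z.big-cong (λ y → ≡.cong (_whenℤ z ≤? y) (μ-row y u)) ⟩
      ∑ℤ (λ y → (+ 1 whenℤ y ≟ u) whenℤ z ≤? y)
        ≡⟨ Z′.big-single-when (z ≤?_) (+ 1) u ⟩
      (+ 1 whenℤ z ≤? u)
        ≡⟨ Z′.big-single-when (_≤? u) (+ 1) z ⟨
      ∑ℤ (λ x → (+ 1 whenℤ x ≟ z) whenℤ x ≤? u) ∎
    where open ≡.≡-Reasoning

  -- The weights carry the exponents -μ(y,x), and this is their total over y ≥ z. The sums of -μ and
  -- of μ cancel termwise, so one is the inverse of the other.
  neg-μ-column : ∀ z x → ∑ℤ (λ y → ℤ.- μ y x whenℤ z ≤? y) ≡ (-[1+ 0 ] whenℤ x ≟ z)
  neg-μ-column z x = begin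
    ∑ℤ (λ y → ℤ.- μ y x whenℤ z ≤? y)        ≡⟨ inverseˡ-unique _ _ cancels ⟩
    ℤ.- ∑ℤ (λ y → μ y x whenℤ z ≤? y)        ≡⟨ ≡.cong ℤ.-_ (μ-column z x) ⟩
    ℤ.- (+ 1 whenℤ x ≟ z)                    ≡⟨ if-float ℤ.-_ (does (x ≟ z)) ⟩
    (-[1+ 0 ] whenℤ x ≟ z)                   ∎
    where
    open ≡.≡-Reasoning
    open GroupProperties ℤ+.group using (inverseˡ-unique)

    cancels : ∑ℤ (λ y → ℤ.- μ y x whenℤ z ≤? y) ℤ.+ ∑ℤ (λ y → μ y x whenℤ z ≤? y) ≡ + 0
    cancels = ≡.trans
      (≡.sym (Z′.big-∙ (λ y → ℤ.- μ y x whenℤ z ≤? y) (λ y → μ y x whenℤ z ≤? y)))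
      (Z′.big-ε (λ y → ≡.trans (≡.sym (Z′.when-∙ (ℤ.- μ y x) (μ y x) (z ≤? y)))
        (≡.trans (≡.cong (_whenℤ z ≤? y) (ℤ.+-inverseˡ (μ y x))) (Z′.ε-when (z ≤? y)))))

  -- The co-Möbius transform and the Dempster rule.

  private
    -- `coMöbius f` is `ζᵒ (möbius f)` by definition. Separating `ζᵒ` allows computing with
    -- explicitly given Möbius transforms, which `möbius (fromMöbius m)` matches only up to `≈`.
    ζᵒ : (Elem → Real) → Elem → Real
    ζᵒ m x = ∑ λ y → m y when x ≤? y

    ζᵒ-cong : ∀ {m n} → (∀ x → m x ≈ n x) → ∀ x → ζᵒ m x ≈ ζᵒ n x
    ζᵒ-cong eq x = S.big-cong (λ y → S′.when-cong (x ≤? y) (λ _ → eq y))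

  open SetoidReasoning R.setoid

  ∑-*-∑ : ∀ f g → ∑ (λ x → ∑ λ y → f x * g y) ≈ ∑ f * ∑ g
  ∑-*-∑ f g = R.trans
    (S.big-cong (λ x → R.sym (*-distribˡ-sum (f x) (g ∘ L.elem))))
    (R.sym (*-distribʳ-sum (∑ g) (f ∘ L.elem)))
    where
    open SemiringSum (CommutativeRing.semiring R.commutativeRing)

  -- The terms factor because z ≤ y₁ ∧ y₂ means z ≤ y₁ and z ≤ y₂.
  ζᵒ-⊕ᵐ : ∀ m n z → ζᵒ (m ⊕ᵐ n) z ≈ ζᵒ m z * ζᵒ n z
  ζᵒ-⊕ᵐ m n z = begin
    ∑ (λ x → ∑ (λ y₁ → ∑ λ y₂ → F y₁ y₂ x) when z ≤? x)
      ≈⟨ S.big-cong (λ x → S′.big-when (λ y₁ → ∑ λ y₂ → F y₁ y₂ x) (z ≤? x)) ⟩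
    ∑ (λ x → ∑ λ y₁ → ∑ (λ y₂ → F y₁ y₂ x) when z ≤? x)
      ≈⟨ S′.big-swap (λ x y₁ → ∑ (λ y₂ → F y₁ y₂ x) when z ≤? x) ⟩
    ∑ (λ y₁ → ∑ λ x → ∑ (λ y₂ → F y₁ y₂ x) when z ≤? x)
      ≈⟨ S.big-cong (λ y₁ → S.big-cong λ x → S′.big-when (λ y₂ → F y₁ y₂ x) (z ≤? x)) ⟩
    ∑ (λ y₁ → ∑ λ x → ∑ λ y₂ → F y₁ y₂ x when z ≤? x)
      ≈⟨ S.big-cong (λ y₁ → S′.big-swap (λ x y₂ → F y₁ y₂ x when z ≤? x)) ⟩
    ∑ (λ y₁ → ∑ λ y₂ → ∑ λ x → F y₁ y₂ x when z ≤? x)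
      ≈⟨ S.big-cong (λ y₁ → S.big-cong (collapse y₁)) ⟩
    ∑ (λ y₁ → ∑ λ y₂ → (m y₁ when z ≤? y₁) * (n y₂ when z ≤? y₂))
      ≈⟨ ∑-*-∑ (λ y₁ → m y₁ when z ≤? y₁) (λ y₂ → n y₂ when z ≤? y₂) ⟩
    ζᵒ m z * ζᵒ n z ∎
    where
    F : Elem → Elem → Elem → Real
    F y₁ y₂ x = m y₁ * n y₂ when (y₁ ∧ y₂) ≟ x

    split : ∀ y₁ y₂ → (m y₁ * n y₂ when z ≤? (y₁ ∧ y₂)) ≈
                      (m y₁ when z ≤? y₁) * (n y₂ when z ≤? y₂)
    split y₁ y₂ with z ≤? y₁ | z ≤? y₂
    ... | yes z≤y₁ | yes z≤y₂ =
      R.reflexive (S′.when-true _ (z ≤? (y₁ ∧ y₂)) (L.∧-greatest z≤y₁ z≤y₂))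
    ... | yes _    | no z≰y₂  = R.trans
      (R.reflexive (S′.when-false _ (z ≤? (y₁ ∧ y₂)) (λ p → z≰y₂ (L.trans p (L.x∧y≤y y₁ y₂)))))
      (R.sym (R.zeroʳ _))
    ... | no z≰y₁  | _        = R.trans
      (R.reflexive (S′.when-false _ (z ≤? (y₁ ∧ y₂)) (λ p → z≰y₁ (L.trans p (L.x∧y≤x y₁ y₂)))))
      (R.sym (R.zeroˡ _))

    collapse : ∀ y₁ y₂ → ∑ (λ x → F y₁ y₂ x when z ≤? x) ≈
                         (m y₁ when z ≤? y₁) * (n y₂ when z ≤? y₂)
    collapse y₁ y₂ = begin
      ∑ (λ x → F y₁ y₂ x when z ≤? x)
        -- Only x = y₁ ∧ y₂ contributes. The equation is turned around because `big-single-when`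
        -- compares the summation variable on the left.
        ≈⟨ S.big-cong (λ x → R.reflexive (≡.cong (_when z ≤? x)
             (S′.when-⇔ _ ((y₁ ∧ y₂) ≟ x) (x ≟ (y₁ ∧ y₂)) ≡.sym ≡.sym))) ⟩
      ∑ (λ x → (m y₁ * n y₂ when x ≟ (y₁ ∧ y₂)) when z ≤? x)
        ≈⟨ S′.big-single-when (z ≤?_) _ (y₁ ∧ y₂) ⟩
      (m y₁ * n y₂ when z ≤? (y₁ ∧ y₂))
        ≈⟨ split y₁ y₂ ⟩
      (m y₁ when z ≤? y₁) * (n y₂ when z ≤? y₂) ∎

  möbius-fromMöbius : ∀ m x → möbius (fromMöbius m) x ≈ m x
  möbius-fromMöbius m x = R.sym (möbius-unique (fromMöbius m) m (λ _ → R.refl) x)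

  coMöbius-fromMöbius : ∀ m z → coMöbius (fromMöbius m) z ≈ ζᵒ m z
  coMöbius-fromMöbius m = ζᵒ-cong (möbius-fromMöbius m)

  coMöbius-⊕ : ∀ f g z → coMöbius (f ⊕ g) z ≈ coMöbius f z * coMöbius g z
  coMöbius-⊕ f g z =
    R.trans (coMöbius-fromMöbius (möbius f ⊕ᵐ möbius g) z) (ζᵒ-⊕ᵐ (möbius f) (möbius g) z)

  coMöbius-vacuous : ∀ z → coMöbius vacuous z ≈ 1#
  coMöbius-vacuous z = begin
    coMöbius vacuous z                     ≈⟨ coMöbius-fromMöbius (λ x → 1# when x ≟ ⊤) z ⟩
    ∑ (λ x → (1# when x ≟ ⊤) when z ≤? x)  ≈⟨ S′.big-single-when (z ≤?_) 1# ⊤ ⟩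
    (1# when z ≤? ⊤)                       ≡⟨ S′.when-true 1# (z ≤? ⊤) (L.maximum z) ⟩
    1#                                     ∎

  coMöbius-⨁ : ∀ f z → coMöbius (⨁ f) z ≈ ∏ λ y → coMöbius (f y) z
  coMöbius-⨁ f z = go (f ∘ L.elem)
    where
    -- Generalised from the enumeration of the lattice to any finite family, so that induction on
    -- its length applies; `vacuous` matches the empty product.
    go : ∀ {n} (t : Fin n → Elem → Real) →
         coMöbius (Vector.foldr _⊕_ vacuous t) z ≈
         MonoidSum.sum R.*-commutativeMonoid (λ i → coMöbius (t i) z)
    go {ℕ.zero}  t = coMöbius-vacuous z
    go {ℕ.suc n} t = R.trans (coMöbius-⊕ (t Fin.zero) _ z) (R.*-congˡ (go (t ∘ Fin.suc)))

  -- Stated as a factorisation of w so that ∏ w splits into the product over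
  -- y ≥ z and the co-Möbius transform of the decomposition.
  coMöbius-^ : ∀ y w z → (w when* z ≤? y) * coMöbius (y ^ w) z ≈ w
  coMöbius-^ y w z = begin
    (w when* z ≤? y) * coMöbius (y ^ w) z
      ≈⟨ R.*-congˡ (coMöbius-fromMöbius (λ x → m₁ x + m₂ x) z) ⟩
    (w when* z ≤? y) * ∑ (λ x → m₁ x + m₂ x when z ≤? x)
      ≈⟨ R.*-congˡ (S.big-cong (λ x → S′.when-∙ (m₁ x) (m₂ x) (z ≤? x))) ⟩
    (w when* z ≤? y) * ∑ (λ x → (m₁ x when z ≤? x) + (m₂ x when z ≤? x))
      ≈⟨ R.*-congˡ (S′.big-∙ (λ x → m₁ x when z ≤? x) (λ x → m₂ x when z ≤? x)) ⟩
    (w when* z ≤? y) * (∑ (λ x → m₁ x when z ≤? x) + ∑ (λ x → m₂ x when z ≤? x))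
      ≈⟨ R.*-congˡ (R.+-cong (S′.big-single-when (z ≤?_) (1# - w) y)
                             (S′.big-single-when (z ≤?_) w ⊤)) ⟩
    (w when* z ≤? y) * ((1# - w when z ≤? y) + (w when z ≤? ⊤))
      ≡⟨ ≡.cong (λ v → (w when* z ≤? y) * ((1# - w when z ≤? y) + v))
           (S′.when-true w (z ≤? ⊤) (L.maximum z)) ⟩
    (w when* z ≤? y) * ((1# - w when z ≤? y) + w)
      ≈⟨ cases ⟩
    w ∎
    where
    m₁ m₂ : Elem → Real
    m₁ x = 1# - w when x ≟ y
    m₂ x = w when x ≟ ⊤

    cases : (w when* z ≤? y) * ((1# - w when z ≤? y) + w) ≈ w
    cases with z ≤? y
    ... | yes _ = R.trans
      (R.*-congˡ (GroupProperties.//-rightDividesˡ R.+-group w 1#)) (R.*-identityʳ w)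
    ... | no  _ = R.trans (R.*-identityˡ _) (R.+-identityˡ w)

  -- Equal sums over upper sets force equal Möbius transforms by `ζᵒ-injective`, and a function is
  -- rebuilt from its Möbius transform.
  coMöbius-injective : ∀ {f g} → (∀ x → coMöbius f x ≈ coMöbius g x) → ∀ x → f x ≈ g x
  coMöbius-injective {f} {g} eq x = begin
    f x                               ≈⟨ möbius-correct f x ⟩
    ∑ (λ y → möbius f y when y ≤? x)  ≈⟨ S.big-cong (λ y → S′.when-cong (y ≤? x) (λ _ → m≈ y)) ⟩
    ∑ (λ y → möbius g y when y ≤? x)  ≈⟨ möbius-correct g x ⟨
    g x                               ∎
    where
    m≈ : ∀ y → möbius f y ≈ möbius g y
    m≈ = ζᵒ-injective L R.+-commutativeMonoid
           (λ k i j → GroupProperties.∙-cancelʳ R.+-group k i j) (möbius f) (möbius g) eq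

  -- Every element lies above ⊥ and below ⊤, so both sides are the total of the Möbius transform.
  coMöbius-⊥ : ∀ f → coMöbius f ⊥ ≈ f ⊤
  coMöbius-⊥ f = R.trans
    (S.big-cong (λ y → R.reflexive (S′.when-⇔ (möbius f y) (⊥ ≤? y) (y ≤? ⊤)
      (λ _ → L.maximum y) (λ _ → L.minimum y))))
    (R.sym (möbius-correct f ⊤))

  -- Products of the weights and the decomposition.

  module _ {bel : Elem → Real} (isBelief : IsBelief bel) (m⊤#0 : möbius bel ⊤ # 0#) where
    open RealPowers ℝ
    private
      q   = coMöbius bel
      q#0 = coMöbius#0 isBelief m⊤#0
      w   = weight isBelief m⊤#0
      q⁻¹ = λ x → R.inverse (q x) (q#0 x)

      factor : Elem → Elem → Real
      factor x y = pow (q x) (q#0 x) (ℤ.- μ y x)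

    -- If y ≰ x then μ(y,x) = 0 and the power is 1. With the range of x no longer depending on y,
    -- the products over x and y can be exchanged.
    weight≈ : ∀ y → w y ≈ ∏ λ x → factor x y
    weight≈ y = P.big-cong (λ x → P′.when-redundant (y ≤? x)
      (λ y≰x → R.reflexive (≡.cong (pow (q x) (q#0 x) ∘ ℤ.-_) (μ-≰ y≰x))))

    -- Once the products are exchanged, the exponents of each `q x` add up over y ≥ z; by
    -- `neg-μ-column` the total is -1 at x = z and 0 elsewhere.
    ∏-weight-above : ∀ z → ∏ (λ y → w y when* z ≤? y) ≈ q⁻¹ z
    ∏-weight-above z = begin
      ∏ (λ y → w y when* z ≤? y)
        ≈⟨ P.big-cong (λ y → R.trans (P′.when-cong (z ≤? y) (λ _ → weight≈ y))
                                     (P′.big-when (λ x → factor x y) (z ≤? y))) ⟩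
      ∏ (λ y → ∏ λ x → factor x y when* z ≤? y)
        ≈⟨ P′.big-swap (λ y x → factor x y when* z ≤? y) ⟩
      ∏ (λ x → ∏ λ y → factor x y when* z ≤? y)
        -- Moves the condition into the exponent: the default factor 1 is the power with exponent 0.
        ≈⟨ P.big-cong (λ x → P.big-cong λ y → R.reflexive
             (if-float (pow (q x) (q#0 x)) (does (z ≤? y)) {ℤ.- μ y x} {+ 0})) ⟨
      ∏ (λ x → ∏ λ y → pow (q x) (q#0 x) (ℤ.- μ y x whenℤ z ≤? y))
        ≈⟨ P.big-cong (λ x → pow-sum (q x) (q#0 x)
             (λ i → ℤ.- μ (L.elem i) x whenℤ z ≤? L.elem i)) ⟨
      ∏ (λ x → pow (q x) (q#0 x) (∑ℤ λ y → ℤ.- μ y x whenℤ z ≤? y))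
        ≡⟨ P.big-cong-≡ (λ x → ≡.trans (≡.cong (pow (q x) (q#0 x)) (neg-μ-column z x))
             (if-float (pow (q x) (q#0 x)) (does (x ≟ z)))) ⟩
      -- The power with exponent -1 unfolds to one factor `q⁻¹ x` times the empty product.
      ∏ (λ x → q⁻¹ x * 1# when* x ≟ z)
        ≈⟨ P′.big-≟ (λ x → q⁻¹ x * 1#) z ⟩
      q⁻¹ z * 1#
        ≈⟨ R.*-identityʳ _ ⟩
      q⁻¹ z ∎

    ∏-weight : ∏ w ≈ 1#
    ∏-weight = begin
      ∏ w
        ≡⟨ P.big-cong-≡ (λ y → ≡.sym (P′.when-true (w y) (⊥ ≤? y) (L.minimum y))) ⟩
      ∏ (λ y → w y when* ⊥ ≤? y)  ≈⟨ ∏-weight-above ⊥ ⟩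
      q⁻¹ ⊥                       ≈⟨ R.*-identityʳ _ ⟨
      -- The normalisation bel(⊤) = 1 enters here, as q(⊥) = 1.
      q⁻¹ ⊥ * 1#                  ≈⟨ R.*-congˡ (R.trans (coMöbius-⊥ bel) (IsBelief.bel-⊤ isBelief)) ⟨
      q⁻¹ ⊥ * q ⊥                 ≈⟨ R.inverse-correct (q ⊥) (q#0 ⊥) ⟩
      1#                          ∎

    coMöbius-decomposition : ∀ z → q z ≈ coMöbius (⨁ λ y → y ^ w y) z
    coMöbius-decomposition z = begin
      q z
        ≈⟨ R.*-identityʳ _ ⟨
      q z * 1#
        -- The 1 is inserted as the product of all weights, so that `coMöbius-^` can split each of
        -- them; the part over y ≥ z then cancels `q z`.
        ≈⟨ R.*-congˡ ∏-weight ⟨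
      q z * ∏ w
        ≈⟨ R.*-congˡ (P.big-cong (λ y → coMöbius-^ y (w y) z)) ⟨
      q z * ∏ (λ y → (w y when* z ≤? y) * Q y)
        ≈⟨ R.*-congˡ (P′.big-∙ (λ y → w y when* z ≤? y) Q) ⟩
      q z * (∏ (λ y → w y when* z ≤? y) * ∏ Q)
        ≈⟨ R.*-congˡ (R.*-congʳ (∏-weight-above z)) ⟩
      q z * (q⁻¹ z * ∏ Q)
        ≈⟨ R.*-assoc _ _ _ ⟨
      q z * q⁻¹ z * ∏ Q
        ≈⟨ R.*-congʳ (R.trans (R.*-comm _ _) (R.inverse-correct (q z) (q#0 z))) ⟩
      1# * ∏ Q
        ≈⟨ R.*-identityˡ _ ⟩
      ∏ Q
        ≈⟨ coMöbius-⨁ (λ y → y ^ w y) z ⟨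
      coMöbius (⨁ λ y → y ^ w y) z ∎
      where
      Q : Elem → Real
      Q y = coMöbius (y ^ w y) z

theorem1 : ∀ {c ℓ₁ ℓ₂ ℓ₃ a ℓ} (ℝ : Reals c ℓ₁ ℓ₂ ℓ₃) (L : FiniteLattice a ℓ) →
    let open BeliefFunctions ℝ L in
    (bel : Elem → Real) (isBelief : IsBelief bel) (m⊤≠0 : möbius bel ⊤ # 0#) →
    ∀ x → bel x ≈ (⨁ λ y → y ^ weight isBelief m⊤≠0 y) x
theorem1 ℝ L bel isBelief m⊤≠0 =
  coMöbius-injective ℝ L (coMöbius-decomposition ℝ L isBelief m⊤≠0)
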